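{- Every simple theory is rosy. Moreover, in a simple theory, for any sets $A,B,C$, if $A$ is forking-independent from $B$ over $C$, then $A\perp^{þ}_C B$.
   Context: $T$ is a complete first-order theory with monster model $\mathcal C$ (saturated, of large cardinality); all sets, tuples, types and models are small and live inside $\mathcal C$. One works in $\mathcal C^{eq}$. A family $\{\delta(x,a')\}_{a'\in S}$ is $k$-inconsistent if $\bigwedge_{i=1}^k\delta(x,a_i)$ is inconsistent for all pairwise distinct $a_1,\dots,a_k\in S$. A formula $\delta(x,a)$ strongly divides over $A$ if $tp(a/A)$ is non-algebraic and $\{\delta(x,a')\}_{a'\models tp(a/A)}$ is $k$-inconsistent for some $k\in\mathbb N$. It þ-divides over $A$ if there is a tuple $c$ such that $\delta(x,a)$ strongly divides over $Ac$. A formula þ-forks over $A$ if it implies a finite disjunction of formulas (with parameters) each of which þ-divides over $A$. A type þ-forks over $A$ if it contains a formula which þ-forks over $A$. $A\perp^{þ}_C B$ means that the type of (an enumeration of) $A$ over $BC$ does not þ-fork over $C$. þ-rank: for a formula $\phi$ (with parameters) in $x$, a set $\Delta$ of parameter-free formulas in variables $x;y$, a set $\Pi$ of parameter-free formulas in variables $y;z$ ($z$ possibly of infinite length), and $k\in\mathbb N$, define þ$(\phi,\Delta,\Pi,k)$ inductively: (1) þ$(\phi,\Delta,\Pi,k)\ge 0$ if $\phi$ is consistent; (2) for $\lambda$ a limit ordinal, þ$(\phi,\Delta,\Pi,k)\ge\lambda$ iff þ$(\phi,\Delta,\Pi,k)\ge\alpha$ for all $\alpha<\lambda$; (3) þ$(\phi,\Delta,\Pi,k)\ge\alpha+1$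 iff there are $\delta\in\Delta$, $\pi(y;z)\in\Pi$ and parameters $c$ such that þ$(\phi\wedge\delta(x,a),\Delta,\Pi,k)\ge\alpha$ for infinitely many $a\models\pi(y;c)$, and $\{\delta(x,a)\}_{a\models\pi(y;c)}$ is $k$-inconsistent. For a type $p$, þ$(p,\Delta,\Pi,k)=\min\{$þ$(\phi,\Delta,\Pi,k):\phi\in p\}$. $T$ is rosy if þ$(p,\Delta,\Pi,k)$ is finite for every type $p$, all finite sets $\Delta,\Pi$ of formulas and every $k\in\mathbb N$. -}

module Defs where

open import Level using (Level; _⊔_; 0ℓ) renaming (suc to lsuc)
open import Data.Empty using (⊥; ⊥-elim)
open import Data.Fin.Base using (Fin)
open import Data.List.Base using (List; []; _∷_; _∷ʳ_; applyUpTo)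
open import Data.List.Membership.Propositional using () renaming (_∈_ to _∈ˡ_)
open import Data.List.Relation.Unary.All using (All)
open import Data.List.Relation.Unary.Any using (Any)
open import Data.Maybe.Base using (Maybe; just; nothing; maybe′)
open import Data.Nat.Base using (ℕ; zero; suc; _<_)
open import Data.Product.Base using (Σ; Σ-syntax; ∃; ∃-syntax; _×_; _,_; proj₁; proj₂)
open import Data.Sum.Base using (_⊎_; inj₁; inj₂)
import Data.Sum.Base as Sum
open import Function.Base using (_∘_)
open import Function.Definitions using (Injective)
open import Relation.Binary.Bundles using (Setoid)
open import Relation.Binary.PropositionalEquality.Core using (_≡_; _≢_)
open import Relation.Binary.Structures using (IsEquivalence)
open import Relation.Nullary.Negation.Core using (¬_)
open import Relation.Unary using (Pred; _∈_)

private variable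
  a l m p v w ℓ : Level

-- Many-sorted first-order logic.  Equality is interpreted by a setoid on each
-- sort, so that the quotient sorts of C^eq can be formed.

record Ctx (S : Set a) (v : Level) : Set (a ⊔ lsuc v) where
  constructor ctx
  field
    Var  : Set v
    sort : Var → S

open Ctx public

∅ᶜ : {S : Set a} → Ctx S 0ℓ
∅ᶜ = ctx ⊥ ⊥-elim

_▷_ : {S : Set a} → Ctx S v → S → Ctx S v
Γ ▷ s = ctx (Maybe (Var Γ)) (maybe′ (sort Γ) s)

_⊎ᶜ_ : {S : Set a} → Ctx S v → Ctx S w → Ctx S (v ⊔ w)
Γ ⊎ᶜ Δ = ctx (Var Γ ⊎ Var Δ) Sum.[ sort Γ , sort Δ ]

record Arity (S : Set a) : Set a where
  constructor arity
  field
    len : ℕ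
    at  : Fin len → S

vars : {S : Set a} → Arity S → Ctx S 0ℓ
vars (arity n s) = ctx (Fin n) s

record Language (l : Level) : Set (lsuc l) where
  field
    Sort : Set l
    Fun  : Set l
    Rel  : Set l
    dom  : Fun → Arity Sort
    cod  : Fun → Sort
    rar  : Rel → Arity Sort

module _ (L : Language l) where
  open Language L

  data Term (Γ : Ctx Sort v) : Sort → Set (l ⊔ v) where
    var : (x : Var Γ) → Term Γ (sort Γ x)
    app : (f : Fun) → ((i : Fin (Arity.len (dom f))) → Term Γ (Arity.at (dom f) i)) →
          Term Γ (cod f)

  infixr 6 _∧′_

  data Formula (Γ : Ctx Sort v) : Set (l ⊔ v) where
    _≐_  : ∀ {s} → Term Γ s → Term Γ s → Formula Γ
    rel  : (R : Rel) → ((i : Fin (Arity.len (rar R))) → Term Γ (Arity.at (rar R) i)) →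
           Formula Γ
    ¬′_  : Formula Γ → Formula Γ
    _∧′_ : Formula Γ → Formula Γ → Formula Γ
    ∃′   : ∀ s → Formula (Γ ▷ s) → Formula Γ

  Sentence : Set l
  Sentence = Formula ∅ᶜ

  Theory : Set (lsuc l)
  Theory = Pred Sentence l

module _ {L : Language l} where
  open Language L

  Sub : Ctx Sort v → Ctx Sort w → Set (l ⊔ v ⊔ w)
  Sub Γ Δ = (x : Var Γ) → Term L Δ (sort Γ x)

  substᵗ : {Γ : Ctx Sort v} {Δ : Ctx Sort w} → Sub Γ Δ → ∀ {s} → Term L Γ s → Term L Δ s
  substᵗ σ (var x)    = σ x
  substᵗ σ (app f ts) = app f (λ i → substᵗ σ (ts i))

  lift : {Γ : Ctx Sort v} {Δ : Ctx Sort w} → Sub Γ Δ → ∀ {s} → Sub (Γ ▷ s) (Δ ▷ s)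
  lift σ nothing  = var nothing
  lift σ (just x) = substᵗ (λ y → var (just y)) (σ x)

  subst : {Γ : Ctx Sort v} {Δ : Ctx Sort w} → Sub Γ Δ → Formula L Γ → Formula L Δ
  subst σ (t ≐ u)    = substᵗ σ t ≐ substᵗ σ u
  subst σ (rel R ts) = rel R (λ i → substᵗ σ (ts i))
  subst σ (¬′ φ)     = ¬′ subst σ φ
  subst σ (φ ∧′ ψ)   = subst σ φ ∧′ subst σ ψ
  subst σ (∃′ s φ)   = ∃′ s (subst (lift σ) φ)

-- An assignment of elements to the variables of Γ; equivalently, a (possibly
-- infinite) tuple of elements of the sorts listed by Γ.
record Env {S : Set a} (D : S → Setoid m m) (Γ : Ctx S v) : Set (m ⊔ v) where
  constructor env
  field get : (x : Var Γ) → Setoid.Carrier (D (sort Γ x))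

open Env public

module _ {S : Set a} {D : S → Setoid m m} where

  _≋_ : {Γ : Ctx S v} → Env D Γ → Env D Γ → Set (m ⊔ v)
  _≋_ {Γ = Γ} ρ τ = (x : Var Γ) → Setoid._≈_ (D (sort Γ x)) (get ρ x) (get τ x)

  _▷ᵉ_ : {Γ : Ctx S v} {s : S} → Env D Γ → Setoid.Carrier (D s) → Env D (Γ ▷ s)
  get (ρ ▷ᵉ d) nothing  = d
  get (ρ ▷ᵉ d) (just x) = get ρ x

  _∪ᵉ_ : {Γ : Ctx S v} {Δ : Ctx S w} → Env D Γ → Env D Δ → Env D (Γ ⊎ᶜ Δ)
  get (ρ ∪ᵉ τ) (inj₁ x) = get ρ x
  get (ρ ∪ᵉ τ) (inj₂ y) = get τ y

  ∅ᵉ : Env D ∅ᶜ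
  get ∅ᵉ ()

record Structure (L : Language l) (m : Level) : Set (l ⊔ lsuc m) where
  open Language L
  field
    Dom      : Sort → Setoid m m
    fun      : (f : Fun) → Env Dom (vars (dom f)) → Setoid.Carrier (Dom (cod f))
    fun-cong : ∀ f {ρ τ} → ρ ≋ τ → Setoid._≈_ (Dom (cod f)) (fun f ρ) (fun f τ)
    relᴹ     : (R : Rel) → Env Dom (vars (rar R)) → Set m
    rel-resp : ∀ R {ρ τ} → ρ ≋ τ → relᴹ R ρ → relᴹ R τ

open Structure public using (Dom)

module _ {L : Language l} (M : Structure L m) where
  open Language L
  open Structure M hiding (Dom)

  ⟦_⟧ᵗ : {Γ : Ctx Sort v} {s : Sort} → Term L Γ s → Env (Dom M) Γ → Setoid.Carrier (Dom M s)
  ⟦ var x ⟧ᵗ    ρ = get ρ x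
  ⟦ app f ts ⟧ᵗ ρ = fun f (env λ i → ⟦ ts i ⟧ᵗ ρ)

  _⊨_[_] : {Γ : Ctx Sort v} → Formula L Γ → Env (Dom M) Γ → Set m
  _⊨_[_] (_≐_ {s} t u) ρ = Setoid._≈_ (Dom M s) (⟦ t ⟧ᵗ ρ) (⟦ u ⟧ᵗ ρ)
  _⊨_[_] (rel R ts)    ρ = relᴹ R (env λ i → ⟦ ts i ⟧ᵗ ρ)
  _⊨_[_] (¬′ φ)        ρ = ¬ _⊨_[_] φ ρ
  _⊨_[_] (φ ∧′ ψ)      ρ = _⊨_[_] φ ρ × _⊨_[_] ψ ρ
  _⊨_[_] (∃′ s φ)      ρ = ∃[ d ] _⊨_[_] φ (_▷ᵉ_ {s = s} ρ d)

  _⊨ᵀ_ : Theory L → Set (l ⊔ m)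
  _⊨ᵀ_ T = ∀ σ → σ ∈ T → _⊨_[_] σ ∅ᵉ

module _ {L : Language l} (M : Structure L m) where
  open Language L
  open Structure M hiding (Dom)

  ⟦⟧ᵗ-cong : {Γ : Ctx Sort v} {s : Sort} (t : Term L Γ s) {ρ τ : Env (Dom M) Γ} → ρ ≋ τ →
             Setoid._≈_ (Dom M s) (⟦_⟧ᵗ M t ρ) (⟦_⟧ᵗ M t τ)
  ⟦⟧ᵗ-cong (var x)    e = e x
  ⟦⟧ᵗ-cong (app f ts) e = fun-cong f (λ i → ⟦⟧ᵗ-cong (ts i) e)

  ≋-sym : {Γ : Ctx Sort v} {ρ τ : Env (Dom M) Γ} → ρ ≋ τ → τ ≋ ρ
  ≋-sym {Γ = Γ} e x = Setoid.sym (Dom M (sort Γ x)) (e x)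

  ⊨-resp : {Γ : Ctx Sort v} (φ : Formula L Γ) {ρ τ : Env (Dom M) Γ} → ρ ≋ τ →
           M ⊨ φ [ ρ ] → M ⊨ φ [ τ ]
  ⊨-resp (_≐_ {s} t u) e h =
    trans (sym (⟦⟧ᵗ-cong t e)) (trans h (⟦⟧ᵗ-cong u e))
    where open Setoid (Dom M s)
  ⊨-resp (rel R ts) e h         = rel-resp R (λ i → ⟦⟧ᵗ-cong (ts i) e) h
  ⊨-resp (¬′ φ)     e h         = λ k → h (⊨-resp φ (≋-sym e) k)
  ⊨-resp (φ ∧′ ψ)   e (h , k)   = ⊨-resp φ e h , ⊨-resp ψ e k
  ⊨-resp (∃′ s φ)   e (d , h)   =
    d , ⊨-resp φ (λ { nothing → Setoid.refl (Dom M s) ; (just x) → e x }) h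

-- The expansion M^eq.

module _ {L : Language l} (M : Structure L m) where
  open Language L

  record DefinableEquivalence : Set (l ⊔ m) where
    field
      ar            : Arity Sort
      E             : Formula L (vars ar ⊎ᶜ vars ar)
      isEquivalence : IsEquivalence {A = Env (Dom M) (vars ar)} (λ a b → M ⊨ E [ a ∪ᵉ b ])

  open DefinableEquivalence

  data EqSort : Set (l ⊔ m) where
    home : Sort → EqSort
    _/E  : DefinableEquivalence → EqSort

  data EqFun : Set (l ⊔ m) where
    old : Fun → EqFun
    π   : DefinableEquivalence → EqFun

  data EqRel : Set (l ⊔ m) where
    old : Rel → EqRel

  homeᵃ : Arity Sort → Arity EqSort
  homeᵃ (arity n s) = arity n (home ∘ s)

  L^eq : Language (l ⊔ m)
  L^eq = record
    { Sort = EqSort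
    ; Fun  = EqFun
    ; Rel  = EqRel
    ; dom  = λ { (old f) → homeᵃ (dom f) ; (π e) → homeᵃ (ar e) }
    ; cod  = λ { (old f) → home (cod f) ; (π e) → e /E }
    ; rar  = λ { (old R) → homeᵃ (rar R) }
    }

  Dom^eq : EqSort → Setoid m m
  Dom^eq (home s) = Dom M s
  Dom^eq (e /E)   = record
    { Carrier       = Env (Dom M) (vars (ar e))
    ; _≈_           = λ a b → M ⊨ E e [ a ∪ᵉ b ]
    ; isEquivalence = isEquivalence e
    }

  unhome : ∀ {α} → Env Dom^eq (vars (homeᵃ α)) → Env (Dom M) (vars α)
  get (unhome ρ) i = get ρ i

  _^eq : Structure L^eq m
  _^eq = record
    { Dom      = Dom^eq
    ; fun      = λ { (old f) ρ → fun f (unhome ρ) ; (π e) ρ → unhome ρ }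
    ; fun-cong = λ { (old f) eq → fun-cong f eq
                   ; (π e) {ρ} {τ} eq →
                       ⊨-resp M (E e)
                         {ρ = unhome ρ ∪ᵉ unhome ρ} {τ = unhome ρ ∪ᵉ unhome τ}
                         (λ { (inj₁ i) → Setoid.refl (Dom M (Arity.at (ar e) i))
                            ; (inj₂ i) → eq i })
                         (IsEquivalence.refl (isEquivalence e)) }
    ; relᴹ     = λ { (old R) ρ → relᴹ R (unhome ρ) }
    ; rel-resp = λ { (old R) eq → rel-resp R eq }
    }
    where open Structure M hiding (Dom)

-- Complete theories and monster models.  "Small" means indexed by a type in
-- Set ℓ, while the monster lives in Set (lsuc ℓ).

_⊩_ : {L : Language ℓ} → Theory L → Sentence L → Set (lsuc (lsuc ℓ))
_⊩_ {ℓ} {L} T σ = (M : Structure L (lsuc ℓ)) → M ⊨ᵀ T → M ⊨ σ [ ∅ᵉ ]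

Complete : {L : Language ℓ} → Theory L → Set (lsuc (lsuc ℓ))
Complete {ℓ} {L} T = (Σ[ M ∈ Structure L (lsuc ℓ) ] M ⊨ᵀ T) × (∀ σ → T ⊩ σ ⊎ T ⊩ (¬′ σ))

module _ {L : Language l} (M : Structure L m) where
  open Language L

  -- p is a set of formulas in the variables X over the parameters b; its finite
  -- subsets are satisfiable in M.
  Consistent : {X : Ctx Sort v} {Y : Ctx Sort w} → Env (Dom M) Y →
               Pred (Formula L (X ⊎ᶜ Y)) p → Set (l ⊔ m ⊔ p ⊔ v ⊔ w)
  Consistent {X = X} b p =
    ∀ φs → All (_∈ p) φs → Σ[ a ∈ Env (Dom M) X ] All (λ φ → M ⊨ φ [ a ∪ᵉ b ]) φs

-- Saturation: every small type, in a small tuple of variables and over a small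
-- set of parameters, is realised.  (Homogeneity plays no role in the notions below
-- and is not required.)
Saturated : {L : Language ℓ} → Structure L (lsuc ℓ) → Set (lsuc (lsuc ℓ))
Saturated {ℓ} {L} C =
  (X Y : Ctx Sort ℓ) (b : Env (Dom C) Y) (p : Pred (Formula L (X ⊎ᶜ Y)) (lsuc ℓ)) →
  Consistent C b p → Σ[ a ∈ Env (Dom C) X ] (∀ φ → φ ∈ p → C ⊨ φ [ a ∪ᵉ b ])
  where open Language L

record MonsterModel {L : Language ℓ} (T : Theory L) : Set (lsuc (lsuc ℓ)) where
  field
    structure : Structure L (lsuc ℓ)
    models    : structure ⊨ᵀ T
    saturated : Saturated structure

module _ {L : Language l} (M : Structure L m) where
  open Language L

  -- T is simple when no formula φ(x;y) has the tree property in its monster model.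
  record TreeProperty (x y : Arity Sort) (φ : Formula L (vars x ⊎ᶜ vars y)) : Set m where
    field
      k            : ℕ
      tree         : List ℕ → Env (Dom M) (vars y)
      inconsistent : ∀ s (i : Fin k → ℕ) → Injective _≡_ _≡_ i →
                     ¬ (Σ[ a ∈ Env (Dom M) (vars x) ]
                         (∀ j → M ⊨ φ [ a ∪ᵉ tree (s ∷ʳ i j) ]))
      -- the formulas at the nonempty initial segments σ↾1, …, σ↾n of a branch σ
      consistent   : ∀ (σ : ℕ → ℕ) n →
                     Σ[ a ∈ Env (Dom M) (vars x) ]
                       (∀ j → j < n → M ⊨ φ [ a ∪ᵉ tree (applyUpTo σ (suc j)) ])

  Simple : Set (l ⊔ m)
  Simple = ∀ x y φ → ¬ TreeProperty x y φ

module _ {S : Set a} {D : S → Setoid m m} {Γ : Ctx S v} where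

  Finite : Pred (Env D Γ) p → Set (m ⊔ v ⊔ p)
  Finite P = Σ[ as ∈ List (Env D Γ) ] (∀ a → a ∈ P → Any (a ≋_) as)

  Infinite : Pred (Env D Γ) p → Set (m ⊔ v ⊔ p)
  Infinite P = ¬ Finite P

-- Ordinals as trees; limᵒ _ f denotes the supremum of the inhabited family f.
data Ord (ℓ : Level) : Set (lsuc ℓ) where
  0ᵒ   : Ord ℓ
  sucᵒ : Ord ℓ → Ord ℓ
  limᵒ : {I : Set ℓ} → I → (I → Ord ℓ) → Ord ℓ

fromℕ : ℕ → Ord ℓ
fromℕ zero    = 0ᵒ
fromℕ (suc n) = sucᵒ (fromℕ n)

ω : Ord ℓ
ω = limᵒ (Level.lift 0) (fromℕ ∘ Level.lower)

-- Below, M plays the role of C^eq, whose language is as large as C because its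
-- sorts carry proofs about C.

module _ {ℓ : Level} {L : Language (lsuc ℓ)} (M : Structure L (lsuc ℓ)) where
  open Language L

  -- A small subset of M, given by an enumeration.
  record SmallSet : Set (lsuc ℓ) where
    constructor small
    field
      {index} : Ctx Sort ℓ
      enum    : Env (Dom M) index

  open SmallSet public

  -- A formula δ(x,a) with its finite tuple of parameters a.
  record Instance (X : Ctx Sort v) : Set (lsuc ℓ ⊔ v) where
    constructor inst
    field
      {ar}   : Arity Sort
      body   : Formula L (X ⊎ᶜ vars ar)
      params : Env (Dom M) (vars ar)

  -- A formula φ(x) with parameters indexed by a small context.
  record ParFormula (X : Ctx Sort v) : Set (lsuc ℓ ⊔ v) where
    constructor pform
    field
      {par}  : Ctx Sort ℓ
      body   : Formula L (X ⊎ᶜ par)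
      params : Env (Dom M) par

module _ {ℓ : Level} {L : Language (lsuc ℓ)} {M : Structure L (lsuc ℓ)} where
  open Language L

  _∪_ : SmallSet M → SmallSet M → SmallSet M
  A ∪ B = small (enum A ∪ᵉ enum B)

  tp : {X : Ctx Sort v} → Env (Dom M) X → (B : SmallSet M) →
       Pred (Formula L (X ⊎ᶜ index B)) (lsuc ℓ)
  tp a B φ = M ⊨ φ [ a ∪ᵉ enum B ]

  Realisations : {X : Ctx Sort v} (B : SmallSet M) →
                 Pred (Formula L (X ⊎ᶜ index B)) (lsuc ℓ) →
                 Pred (Env (Dom M) X) (lsuc ℓ ⊔ v)
  Realisations B p a = ∀ φ → φ ∈ p → M ⊨ φ [ a ∪ᵉ enum B ]

  conj : {X : Ctx Sort v} → ParFormula M X → Instance M X → ParFormula M X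
  conj {X = X} (pform {Z} φ b) (inst {y} δ a) = pform (subst σ φ ∧′ subst τ δ) (b ∪ᵉ a)
    where
    σ : Sub (X ⊎ᶜ Z) (X ⊎ᶜ (Z ⊎ᶜ vars y))
    σ (inj₁ x) = var (inj₁ x)
    σ (inj₂ z) = var (inj₂ (inj₁ z))

    τ : Sub (X ⊎ᶜ vars y) (X ⊎ᶜ (Z ⊎ᶜ vars y))
    τ (inj₁ x) = var (inj₁ x)
    τ (inj₂ y) = var (inj₂ (inj₂ y))

module _ {ℓ : Level} {L : Language (lsuc ℓ)} (M : Structure L (lsuc ℓ)) where
  open Language L

  -- The family {δ(x,a′)}_{a′ ∈ S} is k-inconsistent.
  Inconsistent : ℕ → {X : Ctx Sort v} {Y : Ctx Sort w} → Formula L (X ⊎ᶜ Y) →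
                 Pred (Env (Dom M) Y) p → Set (lsuc ℓ ⊔ v ⊔ w ⊔ p)
  Inconsistent k {X} {Y} δ S =
    (as : Fin k → Env (Dom M) Y) → (∀ i → as i ∈ S) → (∀ i j → i ≢ j → ¬ as i ≋ as j) →
    ¬ (Σ[ x ∈ Env (Dom M) X ] (∀ i → M ⊨ δ [ x ∪ᵉ as i ]))

  module _ {X : Ctx Sort ℓ} where

    Divides : SmallSet M → Instance M X → Set (lsuc ℓ)
    Divides A (inst {y} δ a) =
      Σ[ k ∈ ℕ ] Σ[ as ∈ (ℕ → Env (Dom M) (vars y)) ]
        (∀ i → as i ∈ Realisations A (tp a A)) ×
        (∀ (i : Fin k → ℕ) → Injective _≡_ _≡_ i →
          ¬ (Σ[ x ∈ Env (Dom M) X ] (∀ j → M ⊨ δ [ x ∪ᵉ as (i j) ])))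

    StronglyDivides : SmallSet M → Instance M X → Set (lsuc ℓ)
    StronglyDivides A (inst δ a) =
      Infinite (Realisations A (tp a A)) ×
      (∃[ k ] Inconsistent k δ (Realisations A (tp a A)))

    þ-Divides : SmallSet M → Instance M X → Set (lsuc ℓ)
    þ-Divides A δ = Σ[ c ∈ SmallSet M ] StronglyDivides (A ∪ c) δ

    -- φ(x,b) implies a finite disjunction of formulas satisfying Div.
    ImpliesDisjunctionOf : Pred (Instance M X) (lsuc ℓ) → Pred (ParFormula M X) (lsuc ℓ)
    ImpliesDisjunctionOf Div (pform φ b) =
      Σ[ δs ∈ List (Instance M X) ] All Div δs ×
        (∀ x → M ⊨ φ [ x ∪ᵉ b ] →
          Any (λ δ → M ⊨ Instance.body δ [ x ∪ᵉ Instance.params δ ]) δs)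

    Forks : SmallSet M → Pred (ParFormula M X) (lsuc ℓ)
    Forks A = ImpliesDisjunctionOf (Divides A)

    þ-Forks : SmallSet M → Pred (ParFormula M X) (lsuc ℓ)
    þ-Forks A = ImpliesDisjunctionOf (þ-Divides A)

  -- In both notions the base is the third argument.

  Independent : (A B C : SmallSet M) → Set (lsuc ℓ)
  Independent A B C =
    ¬ (∃[ φ ] φ ∈ tp (enum A) (B ∪ C) × Forks C (pform φ (enum (B ∪ C))))

  þ-Independent : (A B C : SmallSet M) → Set (lsuc ℓ)
  þ-Independent A B C =
    ¬ (∃[ φ ] φ ∈ tp (enum A) (B ∪ C) × þ-Forks C (pform φ (enum (B ∪ C))))

  module þ-Rank {x y : Arity Sort} {z : Ctx Sort ℓ}
                (Δ : Pred (Formula L (vars x ⊎ᶜ vars y)) (lsuc ℓ))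
                (Π : Pred (Formula L (vars y ⊎ᶜ z)) (lsuc ℓ))
                (k : ℕ) where

    infix 4 þ_≥_ þᵗ_≥_

    -- þ φ ≥ α stands for þ(φ,Δ,Π,k) ≥ α.
    þ_≥_ : ParFormula M (vars x) → Ord ℓ → Set (lsuc ℓ)
    þ pform φ b ≥ 0ᵒ = Σ[ a ∈ Env (Dom M) (vars x) ] M ⊨ φ [ a ∪ᵉ b ]
    þ φ ≥ sucᵒ α     =
      ∃[ δ ] δ ∈ Δ × (∃[ π ] π ∈ Π × (Σ[ c ∈ Env (Dom M) z ]
        Infinite (λ a → M ⊨ π [ a ∪ᵉ c ] × þ conj φ (inst δ a) ≥ α) ×
        Inconsistent k δ (λ a → M ⊨ π [ a ∪ᵉ c ])))
    þ φ ≥ limᵒ _ f   = ∀ i → þ φ ≥ f i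

    -- The rank of a type is the minimum of the ranks of its formulas.
    þᵗ_≥_ : {B : SmallSet M} → Pred (Formula L (vars x ⊎ᶜ index B)) (lsuc ℓ) → Ord ℓ →
            Set (lsuc ℓ)
    þᵗ_≥_ {B} p α = ∀ φ → φ ∈ p → þ pform φ (enum B) ≥ α

  -- Types need not be complete, but they are nonempty, so that the minimum
  -- defining their rank exists.
  record IsType {X : Ctx Sort v} (B : SmallSet M)
                (p : Pred (Formula L (X ⊎ᶜ index B)) (lsuc ℓ)) : Set (lsuc ℓ ⊔ v) where
    field
      nonempty   : ∃[ φ ] φ ∈ p
      consistent : Consistent M (enum B) p

  -- Finiteness of the rank is expressed as "not ≥ ω".
  Rosy : Set (lsuc (lsuc ℓ))
  Rosy =
    (x y : Arity Sort) (z : Ctx Sort ℓ)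
    (Δ : List (Formula L (vars x ⊎ᶜ vars y))) (Π : List (Formula L (vars y ⊎ᶜ z))) (k : ℕ)
    (B : SmallSet M) (p : Pred (Formula L (vars x ⊎ᶜ index B)) (lsuc ℓ)) → IsType B p →
    let open þ-Rank (_∈ˡ Δ) (_∈ˡ Π) k in ¬ (þᵗ_≥_ {B} p ω)

{-# OPTIONS --safe #-}

-- A sequence of distinct realisations of tp(a/Ac) is a sequence of realisations of tp(a/A), so
-- þ-dividing implies dividing, whence the second assertion (in any theory).
--
-- For rosiness, suppose that the þ-rank of a formula with respect to Δ, Π, k is infinite.
-- Forgetting Π, one gets from the definition, for each N, an infinitely branching tree of height N
-- of instances of formulas of Δ, consistent along branches and k-inconsistent among the children
-- of a node.  If a tree of height m + n has labels in P ∪ Q, then it contains a tree of height m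
-- with labels in P or one of height n with labels in Q; so some single δ ∈ Δ has trees of all
-- heights.  Replacing classes by representatives transfers these trees from 𝒞^eq to 𝒞, where by
-- saturation they yield one tree of height ω, contradicting simplicity.
module Submission where

open import Defs renaming (lift to liftˢ)
open import Axiom.ExcludedMiddle using (ExcludedMiddle)
open import Data.Empty using (⊥)
open import Data.Fin.Base using (Fin; zero; suc; toℕ; fromℕ<)
open import Data.Fin.Properties using (toℕ<n; toℕ-fromℕ<)
open import Data.List.Base using (List; []; _∷_; _∷ʳ_; length; applyUpTo)
open import Data.List.Membership.Propositional using () renaming (_∈_ to _∈ˡ_)
open import Data.List.Relation.Unary.All as All using (All; []; _∷_)
open import Data.List.Relation.Unary.Any as Any using (Any; here; there)
open import Data.Maybe.Base using (just; nothing)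
open import Data.Nat.Base using (ℕ; zero; suc; _+_; _≤_; _<_; _⊔_; s≤s; s<s)
open import Data.Nat.Properties using
  (<-cmp; +-suc; m≤n⇒m<n∨m≡n; ≤-refl; ≤-trans; m≤m⊔n; m≤n⊔m)
open import Data.Product.Base using (Σ-syntax; ∃-syntax; _×_; _,_; proj₁; proj₂; map₂)
open import Data.Sum.Base as Sum using (_⊎_; inj₁; inj₂)
open import Data.Vec.Functional as Vector using ()
open import Function.Base using (_∘_; const)
open import Function.Bundles using (_⇔_; mk⇔; Equivalence)
open import Function.Definitions using (Injective)
open import Level using (Level; Lift; lift; lower) renaming (_⊔_ to _⊔ˡ_; suc to lsuc)
open import Relation.Binary.Bundles using (Setoid)
open import Relation.Binary.Definitions using (tri<; tri≈; tri>)
open import Relation.Binary.PropositionalEquality as ≡ using (_≡_; _≢_; refl)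
open import Relation.Binary.Structures using (IsEquivalence)
open import Relation.Nullary using (yes; no; ¬_; contradiction)
open import Relation.Unary using (Pred; _∈_; _∩_; _⊆_) renaming (_∪_ to _∪ᵖ_)

open Equivalence using (to; from)

private variable
  l m p q u v w ℓ : Level

-- Semantics of substitution and of blocks of quantifiers

module Semantics {L : Language l} (M : Structure L m) where
  open Language L

  private variable
    Γ : Ctx Sort v
    Δ : Ctx Sort w

  ≋-refl : {ρ : Env (Dom M) Γ} → ρ ≋ ρ
  ≋-refl {Γ = Γ} x = Setoid.refl (Dom M (sort Γ x))

  ⟦_⟧ˢ : Sub {L = L} Γ Δ → Env (Dom M) Δ → Env (Dom M) Γ
  ⟦ σ ⟧ˢ ρ = env λ x → ⟦_⟧ᵗ M (σ x) ρ

  -- The hypothesis is only the pointwise `τ ≋ ⟦ σ ⟧ˢ ρ`: passing under a quantifier preserves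
  -- agreement at each variable, not propositional equality of environments.
  ⟦substᵗ⟧ : (σ : Sub {L = L} Γ Δ) {ρ : Env (Dom M) Δ} {τ : Env (Dom M) Γ} → τ ≋ ⟦ σ ⟧ˢ ρ →
             ∀ {s} (t : Term L Γ s) →
             Setoid._≈_ (Dom M s) (⟦_⟧ᵗ M t τ) (⟦_⟧ᵗ M (substᵗ σ t) ρ)
  ⟦substᵗ⟧ σ e (var x)    = e x
  ⟦substᵗ⟧ σ e (app f ts) = Structure.fun-cong M f (λ i → ⟦substᵗ⟧ σ e (ts i))

  ⟦lift⟧ : (σ : Sub {L = L} Γ Δ) {ρ : Env (Dom M) Δ} {τ : Env (Dom M) Γ} → τ ≋ ⟦ σ ⟧ˢ ρ →
           ∀ {s} (d : Setoid.Carrier (Dom M s)) →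
           _▷ᵉ_ {s = s} τ d ≋ ⟦ liftˢ σ ⟧ˢ (_▷ᵉ_ {s = s} ρ d)
  ⟦lift⟧ σ e {s} d nothing  = Setoid.refl (Dom M s)
  ⟦lift⟧ {Γ = Γ} σ {ρ} e {s} d (just x) =
    Setoid.trans (Dom M (sort Γ x)) (e x)
      (⟦substᵗ⟧ (var ∘ just) {ρ = _▷ᵉ_ {s = s} ρ d} ≋-refl (σ x))

  -- An equivalence, since negation exchanges the two directions in the induction.
  ⊨-subst : (σ : Sub {L = L} Γ Δ) (φ : Formula L Γ) {ρ : Env (Dom M) Δ} {τ : Env (Dom M) Γ} →
            τ ≋ ⟦ σ ⟧ˢ ρ → M ⊨ φ [ τ ] ⇔ M ⊨ subst σ φ [ ρ ]
  ⊨-subst σ (_≐_ {s} t u) e = mk⇔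
    (λ h → trans (sym (⟦substᵗ⟧ σ e t)) (trans h (⟦substᵗ⟧ σ e u)))
    (λ h → trans (⟦substᵗ⟧ σ e t) (trans h (sym (⟦substᵗ⟧ σ e u))))
    where open Setoid (Dom M s)
  ⊨-subst σ (rel R ts) e = mk⇔
    (Structure.rel-resp M R (λ i → ⟦substᵗ⟧ σ e (ts i)))
    (Structure.rel-resp M R (≋-sym M (λ i → ⟦substᵗ⟧ σ e (ts i))))
  ⊨-subst σ (¬′ φ) e = mk⇔ (_∘ from (⊨-subst σ φ e)) (_∘ to (⊨-subst σ φ e))
  ⊨-subst σ (φ ∧′ ψ) e = mk⇔
    (λ (h , k) → to (⊨-subst σ φ e) h , to (⊨-subst σ ψ e) k)
    (λ (h , k) → from (⊨-subst σ φ e) h , from (⊨-subst σ ψ e) k)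
  ⊨-subst σ (∃′ s φ) e = mk⇔
    (λ (d , h) → d , to (⊨-subst (liftˢ σ) φ (⟦lift⟧ σ e d)) h)
    (λ (d , h) → d , from (⊨-subst (liftˢ σ) φ (⟦lift⟧ σ e d)) h)

  ∃-head : ∀ n (s : Fin (suc n) → Sort) → Formula L (Γ ⊎ᶜ vars (arity (suc n) s)) →
           Formula L (Γ ⊎ᶜ vars (arity n (s ∘ suc)))
  ∃-head n s φ = ∃′ (s zero) (subst
    (λ { (inj₁ x)       → var (just (inj₁ x))
       ; (inj₂ zero)    → var nothing
       ; (inj₂ (suc i)) → var (just (inj₂ i)) }) φ)

  ∃* : ∀ n (s : Fin n → Sort) → Formula L (Γ ⊎ᶜ vars (arity n s)) → Formula L Γ
  ∃* zero    s φ = subst (λ { (inj₁ x) → var x }) φ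
  ∃* (suc n) s φ = ∃* n (s ∘ suc) (∃-head n s φ)

  ⊨-∃* : ∀ n (s : Fin n → Sort) (φ : Formula L (Γ ⊎ᶜ vars (arity n s))) {ρ : Env (Dom M) Γ} →
         M ⊨ ∃* n s φ [ ρ ] ⇔ (Σ[ a ∈ Env (Dom M) (vars (arity n s)) ] M ⊨ φ [ ρ ∪ᵉ a ])
  ⊨-∃* {Γ = Γ} zero s φ = mk⇔
    (λ h → (env λ ()) , from (⊨-subst _ φ λ { (inj₁ x) → Setoid.refl (Dom M (sort Γ x)) }) h)
    (λ (a , h) → to (⊨-subst _ φ λ { (inj₁ x) → Setoid.refl (Dom M (sort Γ x)) }) h)
  ⊨-∃* {Γ = Γ} (suc n) s φ {ρ} = mk⇔
    (λ h → let (a , d , k) = to (⊨-∃* n (s ∘ suc) (∃-head n s φ)) h in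
      env (λ { zero → d ; (suc i) → get a i }) ,
      from (⊨-subst _ φ λ { (inj₁ x)       → Setoid.refl (Dom M (sort Γ x))
                          ; (inj₂ zero)    → Setoid.refl (Dom M (s zero))
                          ; (inj₂ (suc i)) → Setoid.refl (Dom M (s (suc i))) }) k)
    (λ (a , h) → from (⊨-∃* n (s ∘ suc) (∃-head n s φ))
      (env (get a ∘ suc) , get a zero ,
       to (⊨-subst _ φ λ { (inj₁ x)       → Setoid.refl (Dom M (sort Γ x))
                         ; (inj₂ zero)    → Setoid.refl (Dom M (s zero))
                         ; (inj₂ (suc i)) → Setoid.refl (Dom M (s (suc i))) }) h))

  -- A language may lack closed formulas, so the empty conjunction is ¬(χ ∧ ¬χ) for a given χ.
  ⋀ : Formula L Γ → ∀ {n} → (Fin n → Formula L Γ) → Formula L Γ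
  ⋀ χ {zero}  φ = ¬′ (χ ∧′ (¬′ χ))
  ⋀ χ {suc n} φ = φ zero ∧′ ⋀ χ (φ ∘ suc)

  ⊨-⋀ : (χ : Formula L Γ) {n : ℕ} (φ : Fin n → Formula L Γ) {ρ : Env (Dom M) Γ} →
        M ⊨ ⋀ χ φ [ ρ ] ⇔ (∀ i → M ⊨ φ i [ ρ ])
  ⊨-⋀ χ {zero}  φ = mk⇔ (λ _ ()) (λ _ (h , k) → k h)
  ⊨-⋀ χ {suc n} φ = mk⇔
    (λ { (h , k) zero → h ; (h , k) (suc i) → to (⊨-⋀ χ (φ ∘ suc)) k i })
    (λ h → h zero , from (⊨-⋀ χ (φ ∘ suc)) (h ∘ suc))

-- Translation of formulas of L^eq into L

module Translation {L : Language l} (M : Structure L m) where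
  open Language L
  open Semantics M
  open DefinableEquivalence

  private variable
    Γ : Ctx (EqSort M) v
    Δ Δ′ : Ctx Sort w
    s : EqSort M

  -- Terms for a representative of an element of sort s.
  Tuple : Ctx Sort w → EqSort M → Set (l ⊔ˡ w)
  Tuple Δ (home s) = Term L Δ s
  Tuple Δ (e /E)   = Sub {L = L} (vars (ar e)) Δ

  Tuples : Ctx (EqSort M) v → Ctx Sort w → Set (l ⊔ˡ v ⊔ˡ w)
  Tuples Γ Δ = (x : Var Γ) → Tuple Δ (sort Γ x)

  eval : ∀ s → Tuple Δ s → Env (Dom M) Δ → Setoid.Carrier (Dom^eq M s)
  eval (home s) t  ρ = ⟦_⟧ᵗ M t ρ
  eval (e /E)   ts ρ = ⟦ ts ⟧ˢ ρ

  evals : Tuples Γ Δ → Env (Dom M) Δ → Env (Dom^eq M) Γ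
  evals {Γ = Γ} θ ρ = env λ x → eval (sort Γ x) (θ x) ρ

  ≋⇒≈ : ∀ e {a b : Env (Dom M) (vars (ar e))} → a ≋ b → Setoid._≈_ (Dom^eq M (e /E)) a b
  ≋⇒≈ e {a} {b} h =
    ⊨-resp M (E e) {ρ = a ∪ᵉ a} {τ = a ∪ᵉ b}
      (λ { (inj₁ i) → Setoid.refl (Dom M (Arity.at (ar e) i)) ; (inj₂ i) → h i })
      (IsEquivalence.refl (isEquivalence e))

  substᵀ : ∀ s → Sub {L = L} Δ Δ′ → Tuple Δ s → Tuple Δ′ s
  substᵀ (home s) σ t  = substᵗ σ t
  substᵀ (e /E)   σ ts = substᵗ σ ∘ ts

  eval-substᵀ : ∀ s (σ : Sub {L = L} Δ Δ′) (t : Tuple Δ s)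
                {ρ : Env (Dom M) Δ} {ρ′ : Env (Dom M) Δ′} → ρ ≋ ⟦ σ ⟧ˢ ρ′ →
                Setoid._≈_ (Dom^eq M s) (eval s t ρ) (eval s (substᵀ s σ t) ρ′)
  eval-substᵀ (home s) σ t  h = ⟦substᵗ⟧ σ h t
  eval-substᵀ (e /E)   σ ts h = ≋⇒≈ e (λ i → ⟦substᵗ⟧ σ h (ts i))

  translateᵗ : Tuples Γ Δ → Term (L^eq M) Γ s → Tuple Δ s
  translateᵗ θ (var x)              = θ x
  translateᵗ θ (app (old f) ts)     = app f (λ i → translateᵗ θ (ts i))
  -- The projection onto a quotient is the identity on carriers, so its arguments already form a
  -- representative.
  translateᵗ θ (app (EqFun.π e) ts) = λ i → translateᵗ θ (ts i)

  eval-translateᵗ : {Γ : Ctx (EqSort M) v} {Δ : Ctx Sort w} (θ : Tuples Γ Δ)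
                    {τ : Env (Dom^eq M) Γ} {ρ : Env (Dom M) Δ} →
                    τ ≋ evals θ ρ → ∀ {s} (t : Term (L^eq M) Γ s) →
                    Setoid._≈_ (Dom^eq M s) (⟦_⟧ᵗ (M ^eq) t τ) (eval s (translateᵗ θ t) ρ)
  eval-translateᵗ θ h (var x)          = h x
  eval-translateᵗ θ h (app (old f) ts) =
    Structure.fun-cong M f (λ i → eval-translateᵗ θ h (ts i))
  eval-translateᵗ θ h (app (EqFun.π e) ts) = ≋⇒≈ e (λ i → eval-translateᵗ θ h (ts i))

  lift▷ : Tuples Γ Δ → ∀ s → Tuples (Γ ▷ home s) (Δ ▷ s)
  lift▷ θ s nothing          = var nothing
  lift▷ {Γ = Γ} θ s (just x) = substᵀ (sort Γ x) (var ∘ just) (θ x)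

  lift⊎ : Tuples Γ Δ → ∀ e → Tuples (Γ ▷ (e /E)) (Δ ⊎ᶜ vars (ar e))
  lift⊎ θ e nothing          = var ∘ inj₂
  lift⊎ {Γ = Γ} θ e (just x) = substᵀ (sort Γ x) (var ∘ inj₁) (θ x)

  translate : Tuples Γ Δ → Formula (L^eq M) Γ → Formula L Δ
  translate θ (_≐_ {home s} t u) = translateᵗ θ t ≐ translateᵗ θ u
  translate θ (_≐_ {e /E} t u)   = subst Sum.[ translateᵗ θ t , translateᵗ θ u ] (E e)
  translate θ (rel (old R) ts)   = rel R (λ i → translateᵗ θ (ts i))
  translate θ (¬′ φ)             = ¬′ translate θ φ
  translate θ (φ ∧′ ψ)           = translate θ φ ∧′ translate θ ψ
  translate θ (∃′ (home s) φ)    = ∃′ s (translate (lift▷ θ s) φ)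
  -- Every tuple of the right sorts represents a class, so a block of quantifiers over tuples covers
  -- all classes.
  translate θ (∃′ (e /E) φ)      = ∃* _ _ (translate (lift⊎ θ e) φ)

  evals-lift▷ : {Γ : Ctx (EqSort M) v} {Δ : Ctx Sort w} (θ : Tuples Γ Δ)
                {τ : Env (Dom^eq M) Γ} {ρ : Env (Dom M) Δ} → τ ≋ evals θ ρ →
                ∀ s d → _▷ᵉ_ {s = home s} τ d ≋ evals (lift▷ θ s) (_▷ᵉ_ {s = s} ρ d)
  evals-lift▷ θ h s d nothing          = Setoid.refl (Dom M s)
  evals-lift▷ {Γ = Γ} θ h s d (just x) =
    Setoid.trans (Dom^eq M (sort Γ x)) (h x) (eval-substᵀ (sort Γ x) (var ∘ just) (θ x) ≋-refl)

  evals-lift⊎ : {Γ : Ctx (EqSort M) v} {Δ : Ctx Sort w} (θ : Tuples Γ Δ)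
                {τ : Env (Dom^eq M) Γ} {ρ : Env (Dom M) Δ} → τ ≋ evals θ ρ →
                ∀ e d → _▷ᵉ_ {s = e /E} τ d ≋ evals (lift⊎ θ e) (ρ ∪ᵉ d)
  evals-lift⊎ θ h e d nothing          = Setoid.refl (Dom^eq M (e /E)) {d}
  evals-lift⊎ {Γ = Γ} θ h e d (just x) =
    Setoid.trans (Dom^eq M (sort Γ x)) (h x) (eval-substᵀ (sort Γ x) (var ∘ inj₁) (θ x) ≋-refl)

  -- In quotient coordinates `τ ≋ evals θ ρ` is agreement up to `E`, so `ρ` may provide any
  -- representatives of the classes in `τ`.
  ⊨-translate : {Γ : Ctx (EqSort M) v} {Δ : Ctx Sort w} (θ : Tuples Γ Δ)
                (φ : Formula (L^eq M) Γ) {τ : Env (Dom^eq M) Γ} {ρ : Env (Dom M) Δ} → τ ≋ evals θ ρ →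
                (M ^eq) ⊨ φ [ τ ] ⇔ M ⊨ translate θ φ [ ρ ]
  ⊨-translate θ (_≐_ {home s} t u) h = mk⇔
    (λ k → trans (sym (eval-translateᵗ θ h t)) (trans k (eval-translateᵗ θ h u)))
    (λ k → trans (eval-translateᵗ θ h t) (trans k (sym (eval-translateᵗ θ h u))))
    where open Setoid (Dom M s)
  ⊨-translate θ (_≐_ {e /E} t u) {τ} {ρ} h = mk⇔
    (λ k → to substE (trans {t₂} {t₁} {u₂} (sym {t₁} {t₂} (eval-translateᵗ θ h t))
                       (trans {t₁} {u₁} {u₂} k (eval-translateᵗ θ h u))))
    (λ k → trans {t₁} {t₂} {u₁} (eval-translateᵗ θ h t)
             (trans {t₂} {u₂} {u₁} (from substE k) (sym {u₁} {u₂} (eval-translateᵗ θ h u))))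
    where
    open Setoid (Dom^eq M (e /E))
    t₁ u₁ t₂ u₂ : Env (Dom M) (vars (ar e))
    t₁ = ⟦_⟧ᵗ (M ^eq) t τ
    u₁ = ⟦_⟧ᵗ (M ^eq) u τ
    t₂ = ⟦ translateᵗ θ t ⟧ˢ ρ
    u₂ = ⟦ translateᵗ θ u ⟧ˢ ρ
    substE : M ⊨ E e [ t₂ ∪ᵉ u₂ ] ⇔ M ⊨ translate θ (t ≐ u) [ ρ ]
    substE = ⊨-subst _ (E e) λ { (inj₁ i) → Setoid.refl (Dom M (Arity.at (ar e) i))
                               ; (inj₂ i) → Setoid.refl (Dom M (Arity.at (ar e) i)) }
  ⊨-translate θ (rel (old R) ts) h = mk⇔
    (Structure.rel-resp M R (λ i → eval-translateᵗ θ h (ts i)))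
    (Structure.rel-resp M R (≋-sym M (λ i → eval-translateᵗ θ h (ts i))))
  ⊨-translate θ (¬′ φ) h = mk⇔ (_∘ from (⊨-translate θ φ h)) (_∘ to (⊨-translate θ φ h))
  ⊨-translate θ (φ ∧′ ψ) h = mk⇔
    (λ (a , b) → to (⊨-translate θ φ h) a , to (⊨-translate θ ψ h) b)
    (λ (a , b) → from (⊨-translate θ φ h) a , from (⊨-translate θ ψ h) b)
  ⊨-translate θ (∃′ (home s) φ) h = mk⇔
    (λ (d , k) → d , to (⊨-translate (lift▷ θ s) φ (evals-lift▷ θ h s d)) k)
    (λ (d , k) → d , from (⊨-translate (lift▷ θ s) φ (evals-lift▷ θ h s d)) k)
  ⊨-translate θ (∃′ (e /E) φ) h = mk⇔
    (λ (d , k) → from (⊨-∃* _ _ _)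
      (d , to (⊨-translate (lift⊎ θ e) φ (evals-lift⊎ θ h e d)) k))
    (λ k → let (d , k′) = to (⊨-∃* _ _ _) k in
      d , from (⊨-translate (lift⊎ θ e) φ (evals-lift⊎ θ h e d)) k′)

  -- Tuples of quotient sorts as tuples of representatives

  record Concatenation (α β : Arity Sort) : Set (l ⊔ˡ m) where
    field
      total      : Arity Sort
      left       : Sub {L = L} (vars α) (vars total)
      right      : Sub {L = L} (vars β) (vars total)
      join       : Env (Dom M) (vars α) → Env (Dom M) (vars β) → Env (Dom M) (vars total)
      left-join  : ∀ a b → a ≋ ⟦ left ⟧ˢ (join a b)
      right-join : ∀ a b → b ≋ ⟦ right ⟧ˢ (join a b)

  -- An arity indexes its variables by `Fin`, so `⊎ᶜ` of two arities is not itself one. Since `left`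
  -- and `right` are terms, which carry their sorts, no transport along equations between sorts
  -- arises.
  concatenate : ∀ n (s : Fin n → Sort) β → Concatenation (arity n s) β
  concatenate zero s β = record
    { total = β ; left = λ () ; right = var ; join = λ _ b → b
    ; left-join = λ _ _ () ; right-join = λ _ _ → ≋-refl }
  concatenate (suc n) s β = record
    { total      = arity (suc (Arity.len total)) (s zero Vector.∷ Arity.at total)
    ; left       = λ { zero → var zero ; (suc i) → substᵗ (var ∘ suc) (left i) }
    ; right      = λ i → substᵗ (var ∘ suc) (right i)
    ; join       = λ a b → env λ { zero    → get a zero
                                 ; (suc i) → get (join (env (get a ∘ suc)) b) i }
    ; left-join  = λ { a b zero    → Setoid.refl (Dom M (s zero))
                     ; a b (suc i) → Setoid.trans (Dom M (s (suc i)))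
                         (left-join _ _ i) (⟦substᵗ⟧ _ ≋-refl (left i)) }
    ; right-join = λ a b i → Setoid.trans (Dom M (Arity.at β i))
                         (right-join _ _ i) (⟦substᵗ⟧ _ ≋-refl (right i))
    }
    where open Concatenation (concatenate n (s ∘ suc) β)

  record Extension (s : EqSort M) (β : Arity Sort) : Set (l ⊔ˡ m) where
    field
      total      : Arity Sort
      block      : Tuple (vars total) s
      rest       : Sub {L = L} (vars β) (vars total)
      join       : Setoid.Carrier (Dom^eq M s) → Env (Dom M) (vars β) → Env (Dom M) (vars total)
      block-join : ∀ d b → Setoid._≈_ (Dom^eq M s) d (eval s block (join d b))
      rest-join  : ∀ d b → b ≋ ⟦ rest ⟧ˢ (join d b)

  extend : ∀ s β → Extension s β
  extend (home s) β = record
    { total      = total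
    ; block      = left zero
    ; rest       = right
    ; join       = λ d → join (env λ _ → d)
    ; block-join = λ d b → left-join (env λ _ → d) b zero
    ; rest-join  = λ d → right-join (env λ _ → d)
    }
    where open Concatenation (concatenate 1 (const s) β)
  extend (e /E) β = record
    { total      = total
    ; block      = left
    ; rest       = right
    ; join       = join
    ; block-join = λ d b → ≋⇒≈ e (left-join d b)
    ; rest-join  = right-join
    }
    where open Concatenation (concatenate _ _ β)

  -- No choice is involved in `flatten`: an element of a quotient sort is given as a tuple, which
  -- serves as its representative.
  record Flattening (α : Arity (EqSort M)) : Set (l ⊔ˡ m) where
    field
      flat          : Arity Sort
      tuples        : Tuples (vars α) (vars flat)
      flatten       : Env (Dom^eq M) (vars α) → Env (Dom M) (vars flat)
      evals-flatten : ∀ a → a ≋ evals tuples (flatten a)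

  flattening : ∀ n (s : Fin n → EqSort M) → Flattening (arity n s)
  flattening zero s = record
    { flat = arity zero (λ ()) ; tuples = λ () ; flatten = λ _ → env λ ()
    ; evals-flatten = λ _ () }
  flattening (suc n) s = record
    { flat          = total
    ; tuples        = λ { zero → block ; (suc i) → substᵀ (s (suc i)) rest (tuples i) }
    ; flatten       = λ a → join (get a zero) (flatten (env (get a ∘ suc)))
    ; evals-flatten = λ { a zero    → block-join _ _
                        ; a (suc i) → Setoid.trans (Dom^eq M (s (suc i)))
                            (evals-flatten _ i)
                            (eval-substᵀ (s (suc i)) rest (tuples i) (rest-join _ _)) }
    }
    where
    open Flattening (flattening n (s ∘ suc))
    open Extension (extend (s zero) flat)

  -- A formula of L, in variables for representatives, which says the same as φ.
  record HomeFormula {x y : Arity (EqSort M)} (φ : Formula (L^eq M) (vars x ⊎ᶜ vars y)) :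
                     Set (l ⊔ˡ m) where
    field
      {x′ y′}          : Arity Sort
      formula          : Formula L (vars x′ ⊎ᶜ vars y′)
      representative   : Env (Dom^eq M) (vars x) → Env (Dom M) (vars x′)
      representativeʸ  : Env (Dom^eq M) (vars y) → Env (Dom M) (vars y′)
      class            : Env (Dom M) (vars x′) → Env (Dom^eq M) (vars x)
      ⊨-representative : ∀ {a b} → (M ^eq) ⊨ φ [ a ∪ᵉ b ] →
                         M ⊨ formula [ representative a ∪ᵉ representativeʸ b ]
      ⊨-class          : ∀ {a b} → M ⊨ formula [ a ∪ᵉ representativeʸ b ] →
                         (M ^eq) ⊨ φ [ class a ∪ᵉ b ]

  module _ {x y : Arity (EqSort M)} (φ : Formula (L^eq M) (vars x ⊎ᶜ vars y)) where

    private
      module X = Flattening (flattening _ (Arity.at x))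
      module Y = Flattening (flattening _ (Arity.at y))

      tuples : Tuples (vars x ⊎ᶜ vars y) (vars X.flat ⊎ᶜ vars Y.flat)
      tuples (inj₁ i) = substᵀ (Arity.at x i) (var ∘ inj₁) (X.tuples i)
      tuples (inj₂ j) = substᵀ (Arity.at y j) (var ∘ inj₂) (Y.tuples j)

      evals-tuples : ∀ {a b c d} → a ≋ evals X.tuples c → b ≋ evals Y.tuples d →
                     (a ∪ᵉ b) ≋ evals tuples (c ∪ᵉ d)
      evals-tuples h k (inj₁ i) = Setoid.trans (Dom^eq M (Arity.at x i)) (h i)
        (eval-substᵀ (Arity.at x i) (var ∘ inj₁) (X.tuples i) ≋-refl)
      evals-tuples h k (inj₂ j) = Setoid.trans (Dom^eq M (Arity.at y j)) (k j)
        (eval-substᵀ (Arity.at y j) (var ∘ inj₂) (Y.tuples j) ≋-refl)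

    homeFormula : HomeFormula φ
    homeFormula = record
      { formula         = translate tuples φ
      ; representative  = X.flatten
      ; representativeʸ = Y.flatten
      ; class           = evals X.tuples
      ; ⊨-representative = to (⊨-translate tuples φ
          (evals-tuples (X.evals-flatten _) (Y.evals-flatten _)))
      ; ⊨-class          = λ {a} → from (⊨-translate tuples φ
          (evals-tuples (λ i → Setoid.refl (Dom^eq M (Arity.at x i))) (Y.evals-flatten _)))
      }

-- Trees of instances of one formula

module _ {L : Language l} (M : Structure L m) where
  open Language L

  SequenceInconsistent : {X : Ctx Sort v} {Y : Ctx Sort w} → ℕ → Formula L (X ⊎ᶜ Y) →
                         (ℕ → Env (Dom M) Y) → Set (m ⊔ˡ v)
  SequenceInconsistent {X = X} k φ as =
    (i : Fin k → ℕ) → Injective _≡_ _≡_ i →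
    ¬ (Σ[ a ∈ Env (Dom M) X ] (∀ j → M ⊨ φ [ a ∪ᵉ as (i j) ]))

  -- The tree property cut off at height `N`: `tree` is total, but the conditions concern nodes of
  -- length 1 to `N`.
  record TreeOfHeight (N k : ℕ) {x y : Arity Sort} (φ : Formula L (vars x ⊎ᶜ vars y)) :
                      Set m where
    field
      tree         : List ℕ → Env (Dom M) (vars y)
      inconsistent : ∀ s → length s < N → SequenceInconsistent k φ (λ i → tree (s ∷ʳ i))
      consistent   : ∀ (σ : ℕ → ℕ) n → n ≤ N →
                     Σ[ a ∈ Env (Dom M) (vars x) ]
                       (∀ j → j < n → M ⊨ φ [ a ∪ᵉ tree (applyUpTo σ (suc j)) ])

-- Labels pass to representatives. Realisations of branches move forward by `representative`; a
-- common realisation of `k` siblings in `M` would move back by `class` to one in `M ^eq`.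
homeTree : {L : Language l} (M : Structure L m) {x y : Arity (EqSort M)}
           (φ : Formula (L^eq M) (vars x ⊎ᶜ vars y)) {N k : ℕ} → TreeOfHeight (M ^eq) N k φ →
           TreeOfHeight M N k (Translation.HomeFormula.formula (Translation.homeFormula M φ))
homeTree M φ t = record
  { tree         = representativeʸ ∘ tree
  ; inconsistent = λ s s<N i i-inj (a , h) →
                     inconsistent s s<N i i-inj (class a , λ j → ⊨-class (h j))
  ; consistent   = λ σ n n≤N → let (a , h) = consistent σ n n≤N in
                     representative a , λ j j<n → ⊨-representative (h j j<n)
  }
  where
  open TreeOfHeight t
  open Translation M
  open HomeFormula (homeFormula φ)

-- Compactness: an infinite tree from trees of every finite height

module Compactness {L : Language ℓ} (𝒞 : Structure L (lsuc ℓ)) (saturated : Saturated 𝒞)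
                   {x y : Arity (Language.Sort L)} (k : ℕ)
                   (φ : Formula L (vars x ⊎ᶜ vars y)) where
  open Language L
  open Semantics 𝒞

  -- One variable for each coordinate of each node, so that a single realisation labels the whole
  -- tree; `Lift` puts the context at the level that `Saturated` asks for.
  Nodes : Ctx Sort ℓ
  Nodes = ctx (Lift ℓ (List ℕ × Fin (Arity.len y))) (Arity.at y ∘ proj₂ ∘ lower)

  ∅ : Ctx Sort ℓ
  ∅ = ctx (Lift ℓ ⊥) (λ ())

  nodes : (List ℕ → Env (Dom 𝒞) (vars y)) → Env (Dom 𝒞) Nodes
  nodes t = env λ { (lift (s , j)) → get (t s) j }

  ∅-env : Env (Dom 𝒞) ∅
  ∅-env = env λ ()

  atNode : List ℕ → Formula L ((Nodes ⊎ᶜ ∅) ⊎ᶜ vars x)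
  atNode s = subst (λ { (inj₁ i) → var (inj₂ i)
                      ; (inj₂ j) → var (inj₁ (inj₁ (lift (s , j)))) }) φ

  jointly : ∀ {n} → (Fin n → List ℕ) → Formula L (Nodes ⊎ᶜ ∅)
  -- `⋀` takes some formula from which to build the empty conjunction, met for instance at branches
  -- of length 0; `atNode []` is at hand.
  jointly s = ∃* _ (Arity.at x) (⋀ (atNode []) (atNode ∘ s))

  ⊨-jointly : ∀ {n} (s : Fin n → List ℕ) (t : List ℕ → Env (Dom 𝒞) (vars y)) →
              𝒞 ⊨ jointly s [ nodes t ∪ᵉ ∅-env ] ⇔
              (Σ[ a ∈ Env (Dom 𝒞) (vars x) ] (∀ i → 𝒞 ⊨ φ [ a ∪ᵉ t (s i) ]))
  ⊨-jointly s t = mk⇔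
    (λ h → map₂ (λ k i → from (atNode⇔ i) (to (⊨-⋀ (atNode []) (atNode ∘ s)) k i))
             (to (⊨-∃* _ (Arity.at x) _) h))
    (λ (a , h) → from (⊨-∃* _ (Arity.at x) _)
      (a , from (⊨-⋀ (atNode []) (atNode ∘ s)) (λ i → to (atNode⇔ i) (h i))))
    where
    atNode⇔ : ∀ {a} i → 𝒞 ⊨ φ [ a ∪ᵉ t (s i) ] ⇔
                        𝒞 ⊨ atNode (s i) [ (nodes t ∪ᵉ ∅-env) ∪ᵉ a ]
    atNode⇔ i = ⊨-subst _ φ λ { (inj₁ i) → Setoid.refl (Dom 𝒞 (Arity.at x i))
                              ; (inj₂ j) → Setoid.refl (Dom 𝒞 (Arity.at y j)) }

  -- The tree property for the fixed `k`, as a set of formulas each about finitely many nodes;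
  -- `jointly` quantifies the realisation away.
  data TreeAxiom : Pred (Formula L (Nodes ⊎ᶜ ∅)) (lsuc ℓ) where
    branch   : (σ : ℕ → ℕ) (n : ℕ) →
               jointly {n} (λ j → applyUpTo σ (suc (toℕ j))) ∈ TreeAxiom
    children : (s : List ℕ) (i : Fin k → ℕ) → Injective _≡_ _≡_ i →
               (¬′ jointly (λ j → s ∷ʳ i j)) ∈ TreeAxiom

  -- A tree of this height satisfies the axiom. The children of `s` lie one level below `s`, whence
  -- the successor.
  height : ∀ {ψ} → ψ ∈ TreeAxiom → ℕ
  height (branch σ n)     = n
  height (children s i _) = suc (length s)

  ⊨-TreeAxiom : ∀ {N ψ} (A : ψ ∈ TreeAxiom) → height A ≤ N → (t : TreeOfHeight 𝒞 N k φ) →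
                𝒞 ⊨ ψ [ nodes (TreeOfHeight.tree t) ∪ᵉ ∅-env ]
  ⊨-TreeAxiom (branch σ n) n≤N t = from (⊨-jointly _ tree)
    (map₂ (λ h j → h (toℕ j) (toℕ<n j)) (consistent σ n n≤N))
    where open TreeOfHeight t
  ⊨-TreeAxiom (children s i i-inj) s<N t h =
    inconsistent s s<N i i-inj (to (⊨-jointly _ tree) h)
    where open TreeOfHeight t

  heights : ∀ {ψs} → All (_∈ TreeAxiom) ψs → ℕ
  heights []       = 0
  heights (A ∷ As) = height A ⊔ heights As

  ⊨-TreeAxioms : ∀ {N ψs} (As : All (_∈ TreeAxiom) ψs) → heights As ≤ N →
                 (t : TreeOfHeight 𝒞 N k φ) →
                 All (λ ψ → 𝒞 ⊨ ψ [ nodes (TreeOfHeight.tree t) ∪ᵉ ∅-env ]) ψs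
  ⊨-TreeAxioms []       h t = []
  ⊨-TreeAxioms (A ∷ As) h t =
    ⊨-TreeAxiom A (≤-trans (m≤m⊔n (height A) (heights As)) h) t ∷
    ⊨-TreeAxioms As (≤-trans (m≤n⊔m (height A) (heights As)) h) t

  -- Finitely many axioms hold in any tree at least as tall as the largest of their heights, so
  -- saturation realises all of them by one labelling.
  treeProperty : (∀ N → TreeOfHeight 𝒞 N k φ) → TreeProperty 𝒞 x y φ
  treeProperty trees = record
    { k            = k
    ; tree         = tree
    ; inconsistent = λ s i i-inj h →
        realises _ (children s i i-inj) (from (⊨-jointly _ tree) h)
    ; consistent   = λ σ n → map₂
        (λ h j j<n → ≡.subst (λ j → 𝒞 ⊨ φ [ _ ∪ᵉ tree (applyUpTo σ (suc j)) ])
                       (toℕ-fromℕ< j<n) (h (fromℕ< j<n)))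
        (to (⊨-jointly (λ j → applyUpTo σ (suc (toℕ j))) tree) (realises _ (branch σ n)))
    }
    where
    finitelySatisfiable : Consistent 𝒞 ∅-env TreeAxiom
    finitelySatisfiable ψs As =
      let t = trees (heights As) in nodes (TreeOfHeight.tree t) , ⊨-TreeAxioms As ≤-refl t

    realisation : Env (Dom 𝒞) Nodes
    realisation = proj₁ (saturated Nodes ∅ ∅-env TreeAxiom finitelySatisfiable)

    realises : ∀ ψ → ψ ∈ TreeAxiom → 𝒞 ⊨ ψ [ realisation ∪ᵉ ∅-env ]
    realises = proj₂ (saturated Nodes ∅ ∅-env TreeAxiom finitelySatisfiable)

    tree : List ℕ → Env (Dom 𝒞) (vars y)
    tree s = env λ j → get realisation (lift (s , j))

-- A rank without the formulas π

module Rank (em : ∀ {a} → ExcludedMiddle a) {L : Language l} (M : Structure L m)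
            {x y : Arity (Language.Sort L)} (k : ℕ) where
  open Language L

  private variable
    P : Pred (Formula L (vars x ⊎ᶜ vars y)) p
    Q : Pred (Formula L (vars x ⊎ᶜ vars y)) q
    U V : Pred (Env (Dom M) (vars x)) u

  _⟨_⟩ : Formula L (vars x ⊎ᶜ vars y) → Env (Dom M) (vars y) → Pred (Env (Dom M) (vars x)) m
  (δ ⟨ a ⟩) b = M ⊨ δ [ b ∪ᵉ a ]

  -- A tree of height `n` with formulas in `P`, where `U` shrinks to the realisations of the
  -- instances met so far. A set in place of a formula spares the substitutions of `conj`; sequences
  -- give branching over ℕ.
  Rank≥ : Pred (Formula L (vars x ⊎ᶜ vars y)) p → ℕ → Pred (Env (Dom M) (vars x)) m →
          Set (l ⊔ˡ m ⊔ˡ p)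
  Rank≥ {p} P zero    U = Lift (l ⊔ˡ p) (∃[ a ] a ∈ U)
  Rank≥     P (suc n) U =
    ∃[ δ ] δ ∈ P × (Σ[ as ∈ (ℕ → Env (Dom M) (vars y)) ]
      SequenceInconsistent M k δ as × (∀ i → Rank≥ P n (U ∩ (δ ⟨ as i ⟩))))

  Rank≥-mono : P ⊆ Q → U ⊆ V → ∀ n → Rank≥ P n U → Rank≥ Q n V
  Rank≥-mono P⊆Q U⊆V zero    (lift (a , a∈U))         = lift (a , U⊆V a∈U)
  Rank≥-mono P⊆Q U⊆V (suc n) (δ , δ∈P , as , inc , r) =
    δ , P⊆Q δ∈P , as , inc , λ i → Rank≥-mono P⊆Q (λ (h , k) → U⊆V h , k) n (r i)

  Rank≥⇒inhabited : ∀ n → Rank≥ P n U → ∃[ a ] a ∈ U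
  Rank≥⇒inhabited zero    (lift r)             = r
  Rank≥⇒inhabited (suc n) (δ , _ , as , _ , r) = map₂ proj₁ (Rank≥⇒inhabited n (r 0))

  -- Let the formula at the root be in `P`. If some child has a `Q`-tree of height `n`, that tree is
  -- as required; otherwise every child has a `P`-tree of height one less than `m`, and these fit
  -- together under the root. The other case is symmetric.
  Rank≥-split : ∀ m n → Rank≥ (P ∪ᵖ Q) (m + n) U → Rank≥ P m U ⊎ Rank≥ Q n U
  Rank≥-split zero    n       r = inj₁ (lift (Rank≥⇒inhabited n r))
  Rank≥-split (suc m) zero    r = inj₂ (lift (Rank≥⇒inhabited (suc m + 0) r))
  Rank≥-split {P = P} {Q = Q} {U = U} (suc m) (suc n) (δ , inj₁ δ∈P , as , inc , r)
    with em {P = ∃[ i ] Rank≥ Q (suc n) (U ∩ (δ ⟨ as i ⟩))}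
  ... | yes (i , h) = inj₂ (Rank≥-mono (λ h → h) proj₁ (suc n) h)
  ... | no ¬h       = inj₁ (δ , δ∈P , as , inc , λ i →
    Sum.[ (λ h → h) , (λ h → contradiction (i , h) ¬h) ] (Rank≥-split m (suc n) (r i)))
  Rank≥-split {P = P} {Q = Q} {U = U} (suc m) (suc n) (δ , inj₂ δ∈Q , as , inc , r)
    with em {P = ∃[ i ] Rank≥ P (suc m) (U ∩ (δ ⟨ as i ⟩))}
  ... | yes (i , h) = inj₁ (Rank≥-mono (λ h → h) proj₁ (suc m) h)
  ... | no ¬h       = inj₂ (δ , δ∈Q , as , inc , λ i →
    Sum.[ (λ h → contradiction (i , h) ¬h) , (λ h → h) ]
      (Rank≥-split (suc m) n
        -- The height `m + suc n` of a child is regrouped as `suc m + n`, since a formula of `Q` at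
        -- the root uses up one level of the share of `Q`.
        (≡.subst (λ j → Rank≥ (P ∪ᵖ Q) j (U ∩ (δ ⟨ as i ⟩))) (+-suc m n) (r i))))

  -- If the first formula has no tree of some height `m`, splitting trees of height `m + n` gives
  -- trees of every height `n` for the rest of the list. The empty list admits no tree of height 1.
  Rank≥-single : ∀ Δ → (∀ n → Rank≥ (_∈ˡ Δ) n U) → ∃[ δ ] (∀ n → Rank≥ (_≡ δ) n U)
  Rank≥-single [] r with r 1
  ... | _ , () , _
  Rank≥-single {U = U} (δ ∷ Δ) r with em {P = ∃[ m ] ¬ Rank≥ (_≡ δ) m U}
  ... | no h = δ , λ m → decide m
    where
    decide : ∀ m → Rank≥ (_≡ δ) m U
    decide m with em {P = Rank≥ (_≡ δ) m U}
    ... | yes r = r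
    ... | no ¬r = contradiction (m , ¬r) h
  ... | yes (m , ¬r) = Rank≥-single Δ λ n →
    Sum.[ (λ h → contradiction h ¬r) , (λ h → h) ]
      (Rank≥-split m n (Rank≥-mono Any.toSum (λ h → h) (m + n) (r (m + n))))

  module _ {δ : Formula L (vars x ⊎ᶜ vars y)} where

    -- A witness of `Rank≥` labels only children, so the label of the current node is passed down as
    -- `root`; beyond height `N` it is repeated.
    tree : ∀ {N U} → Rank≥ (_≡ δ) N U → Env (Dom M) (vars y) → List ℕ → Env (Dom M) (vars y)
    tree r                            root []      = root
    tree {zero}  r                    root (i ∷ s) = root
    tree {suc N} (_ , _ , as , _ , r) root (i ∷ s) = tree {N} (r i) (as i) s

    tree-inconsistent : ∀ {N U} (r : Rank≥ (_≡ δ) N U) root s → length s < N →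
                        SequenceInconsistent M k δ (λ i → tree {N} r root (s ∷ʳ i))
    tree-inconsistent {suc N} (_ , refl , as , inc , r) root []      h       = inc
    tree-inconsistent {suc N} (_ , refl , as , inc , r) root (i ∷ s) (s<s h) =
      tree-inconsistent {N} (r i) (as i) s h

    -- The conclusion includes `a ∈ U` because in a subtree `U` records the instances above it,
    -- which the realisation must also satisfy.
    tree-consistent : ∀ {N U} (r : Rank≥ (_≡ δ) N U) root (σ : ℕ → ℕ) n → n ≤ N →
                      Σ[ a ∈ Env (Dom M) (vars x) ] a ∈ U ×
                        (∀ j → j < n → a ∈ δ ⟨ tree {N} r root (applyUpTo σ (suc j)) ⟩)
    tree-consistent {N} r root σ zero h =
      let (a , a∈U) = Rank≥⇒inhabited N r in a , a∈U , λ _ ()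
    tree-consistent {suc N} (_ , refl , as , _ , r) root σ (suc n) (s≤s h) =
      let (a , (a∈U , k) , k′) = tree-consistent {N} (r (σ 0)) (as (σ 0)) (σ ∘ suc) n h in
      a , a∈U , λ { zero _ → k ; (suc j) (s<s j<n) → k′ j j<n }

    treesOfHeight : ∀ {U} → (∀ N → Rank≥ (_≡ δ) N U) → ∀ N → TreeOfHeight M N k δ
    treesOfHeight r N = record
      { tree         = tree {N} (r N) root
      ; inconsistent = tree-inconsistent {N} (r N) root
      ; consistent   = λ σ n n≤N → map₂ proj₂ (tree-consistent {N} (r N) root σ n n≤N)
      }
      where
      root : Env (Dom M) (vars y)
      -- A tree of height 0 needs a label too, and its own witness has none; height 1 supplies a
      -- tuple.
      root = let (_ , _ , as , _) = r 1 in as 0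

-- From infinite families to sequences

module _ (em : ∀ {a} → ExcludedMiddle a) {S : Set q} {D : S → Setoid m m} {Γ : Ctx S v}
         {P : Pred (Env D Γ) p} (infinite : Infinite P) where

  private
    fresh : (as : List (Env D Γ)) → Σ[ a ∈ Env D Γ ] a ∈ P × ¬ Any (a ≋_) as
    fresh as with em {P = Σ[ a ∈ Env D Γ ] a ∈ P × ¬ Any (a ≋_) as}
    ... | yes h = h
    ... | no ¬h = contradiction (as , listed) infinite
      where
      listed : ∀ a → a ∈ P → Any (a ≋_) as
      listed a a∈P with em {P = Any (a ≋_) as}
      ... | yes h = h
      ... | no ¬k = contradiction (a , a∈P , ¬k) ¬h

    chosen : ℕ → List (Env D Γ)
    chosen zero    = []
    chosen (suc n) = proj₁ (fresh (chosen n)) ∷ chosen n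

  sequence : ℕ → Env D Γ
  sequence n = proj₁ (fresh (chosen n))

  sequence-∈ : ∀ n → sequence n ∈ P
  sequence-∈ n = proj₁ (proj₂ (fresh (chosen n)))

  private
    earlier : ∀ {i n} {a : Env D Γ} → i < n → a ≋ sequence i → Any (a ≋_) (chosen n)
    earlier {n = suc n} (s≤s i≤n) h with m≤n⇒m<n∨m≡n i≤n
    ... | inj₁ i<n  = there (earlier i<n h)
    ... | inj₂ refl = here h

    later-distinct : ∀ {i n} → i < n → ¬ (sequence n ≋ sequence i)
    later-distinct {n = n} i<n h = proj₂ (proj₂ (fresh (chosen n))) (earlier i<n h)

  sequence-distinct : ∀ {i j} → i ≢ j → ¬ (sequence i ≋ sequence j)
  sequence-distinct {i} {j} i≢j h with <-cmp i j
  ... | tri< i<j _ _ = later-distinct i<j (λ x → Setoid.sym (D (sort Γ x)) (h x))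
  ... | tri≈ _ i≡j _ = i≢j i≡j
  ... | tri> _ _ j<i = later-distinct j<i h

-- From þ-dividing to dividing, and from þ-rank to trees

module _ (em : ∀ {a} → ExcludedMiddle a) {L : Language (lsuc ℓ)} (M : Structure L (lsuc ℓ)) where
  open Language L
  open Semantics M

  -- `Inconsistent` speaks of distinct parameters, `SequenceInconsistent` of distinct indices; the
  -- chosen sequence is injective up to `≋`, so the former yields the latter.
  sequence-inconsistent : {X : Ctx Sort v} {Y : Ctx Sort w} {P Q : Pred (Env (Dom M) Y) p}
                          {k : ℕ} (δ : Formula L (X ⊎ᶜ Y)) (infinite : Infinite Q) → Q ⊆ P →
                          Inconsistent M k δ P →
                          SequenceInconsistent M k δ (sequence em infinite)
  sequence-inconsistent δ infinite Q⊆P inc i i-inj =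
    inc (sequence em infinite ∘ i) (λ j → Q⊆P (sequence-∈ em infinite (i j)))
      (λ j j′ j≢j′ → sequence-distinct em infinite (j≢j′ ∘ i-inj))

  module _ {X : Ctx Sort ℓ} where

    þ-Divides⇒Divides : ∀ {A} (δ : Instance M X) → þ-Divides M A δ → Divides M A δ
    þ-Divides⇒Divides {A} (inst {y} δ a) (c , infinite , k , inc) =
      k , sequence em infinite ,
      (λ i φ h → from (over-Ac φ) (sequence-∈ em infinite i (subst wk φ) (to (over-Ac φ) h))) ,
      sequence-inconsistent δ infinite (λ h → h) inc
      where
      wk : Sub {L = L} (vars y ⊎ᶜ index A) (vars y ⊎ᶜ index (A ∪ c))
      wk (inj₁ i) = var (inj₁ i)
      wk (inj₂ j) = var (inj₂ (inj₁ j))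

      over-Ac : ∀ φ {b} → M ⊨ φ [ b ∪ᵉ enum A ] ⇔ M ⊨ subst wk φ [ b ∪ᵉ enum (A ∪ c) ]
      over-Ac φ = ⊨-subst wk φ λ { (inj₁ i) → Setoid.refl (Dom M (Arity.at y i))
                                 ; (inj₂ j) → Setoid.refl (Dom M (sort (index A) j)) }

  -- Forking and þ-forking differ only in the condition on the disjuncts, so a disjunction
  -- witnessing þ-forking also witnesses forking.
  Independent⇒þ-Independent : ∀ A B C → Independent M A B C → þ-Independent M A B C
  Independent⇒þ-Independent A B C ind (φ , φ∈tp , δs , þ-divide , implies) =
    ind (φ , φ∈tp , δs , All.map (λ {δ} → þ-Divides⇒Divides δ) þ-divide , implies)

  module _ {x y : Arity Sort} {z : Ctx Sort ℓ}
           {Δ : Pred (Formula L (vars x ⊎ᶜ vars y)) (lsuc ℓ)}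
           {Π : Pred (Formula L (vars y ⊎ᶜ z)) (lsuc ℓ)} {k : ℕ} where
    open þ-Rank M Δ Π k
    open Rank em M {x} {y} k

    ⊨-conj : ∀ φ (δ : Instance M (vars x)) {a} →
             M ⊨ ParFormula.body (conj φ δ) [ a ∪ᵉ ParFormula.params (conj φ δ) ] →
             M ⊨ ParFormula.body φ [ a ∪ᵉ ParFormula.params φ ] ×
             M ⊨ Instance.body δ [ a ∪ᵉ Instance.params δ ]
    ⊨-conj (pform φ b) (inst δ c) (h , k) =
      from (⊨-subst _ φ λ { (inj₁ i) → Setoid.refl (Dom M _) ; (inj₂ j) → Setoid.refl (Dom M _) }) h ,
      from (⊨-subst _ δ λ { (inj₁ i) → Setoid.refl (Dom M _) ; (inj₂ j) → Setoid.refl (Dom M _) }) k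

    -- The parameters that leave rank at least `n` form an infinite part of the solutions of `π`; a
    -- sequence of distinct ones inherits `k`-inconsistency and labels the children.
    þ≥⇒Rank≥ : ∀ n {φ} → þ φ ≥ fromℕ n →
               Rank≥ Δ n (λ a → M ⊨ ParFormula.body φ [ a ∪ᵉ ParFormula.params φ ])
    þ≥⇒Rank≥ zero    r = lift r
    þ≥⇒Rank≥ (suc n) {φ} (δ , δ∈Δ , _ , _ , c , infinite , inc) =
      δ , δ∈Δ , sequence em infinite , sequence-inconsistent δ infinite proj₁ inc ,
      λ i → Rank≥-mono (λ h → h) (⊨-conj φ (inst δ (sequence em infinite i))) n
              (þ≥⇒Rank≥ n (proj₂ (sequence-∈ em infinite i)))

mainTheorem5 : (∀ {a} → ExcludedMiddle a) →
    {ℓ : Level} (L : Language ℓ) (T : Theory L) → Complete T →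
    (𝔐 : MonsterModel T) → let 𝒞 = MonsterModel.structure 𝔐 in
    Simple 𝒞 →
    Rosy (𝒞 ^eq) ×
    ((A B C : SmallSet (𝒞 ^eq)) → Independent (𝒞 ^eq) A B C → þ-Independent (𝒞 ^eq) A B C)
mainTheorem5 em L T _ 𝔐 simple = rosy , Independent⇒þ-Independent em (𝒞 ^eq)
  where
  open MonsterModel 𝔐 renaming (structure to 𝒞)

  rosy : Rosy (𝒞 ^eq)
  rosy x y z Δ Π k B p isType rank≥ω =
    -- The rank of a type is a minimum, so any one of its formulas has rank at least `ω`, that is,
    -- at least every `n`.
    let (φ , φ∈p) = IsType.nonempty isType
        (δ , r)   = Rank.Rank≥-single em (𝒞 ^eq) k Δ
                      (λ n → þ≥⇒Rank≥ em (𝒞 ^eq) n (rank≥ω φ φ∈p (lift n)))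
        trees     = Rank.treesOfHeight em (𝒞 ^eq) k r
    in simple _ _ _ (Compactness.treeProperty 𝒞 saturated k _ (λ N → homeTree 𝒞 δ (trees N)))
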